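{- For $n\ge 2$ and $m\ge 3$, $sn(C_{2n}(K_m))=n(m-2)$.
   Context: Graphs are finite, undirected and simple. $C_{2n}(K_m)$ is the graph obtained from a $2n$-cycle $C_{2n}=x_1x_2\cdots x_{2n}x_1$ and $n$ pairwise disjoint copies $K^1,\dots,K^n$ of the complete graph $K_m$ by identifying, for each $1\le i\le n$, the edge $x_{2i-1}x_{2i}$ of the cycle with an edge of $K^i$. (So the graph has $nm$ vertices, and the edges not in any $K^i$ are the alternate edges $x_{2i}x_{2i+1}$, $1\le i\le n$, of the cycle, with $x_{2n+1}=x_1$.) Let $G=(V,E)$ be a connected graph with chromatic number $\chi(G)=k\ge 2$. For $S\subset V$, a partial coloring on $G[S]$ is a proper coloring $\mathscr C_0$ of the induced subgraph $G[S]$ with colors from $\{1,\dots,k\}$ (not all colors need be used). It is a Sudoku coloring of $G$ if there is exactly one proper $k$-coloring $V\to\{1,\dots,k\}$ of $G$ whose restriction to $S$ is $\mathscr C_0$. The Sudoku number $sn(G)$ is the smallest $|S|$ such that $G[S]$ admits a Sudoku coloring of $G$. -}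

module Defs where

open import Data.Fin.Base using (Fin; toℕ; remQuot)
import Data.Fin.Properties as Fin
open import Data.Fin.Subset using (Subset; _∈_; ∣_∣)
open import Data.Nat.Base using (ℕ; suc; _*_; _≤_)
import Data.Nat.Properties as ℕ
open import Data.Product.Base using (Σ; ∃; _×_; _,_; proj₁)
open import Data.Product using (∃!)
open import Data.Sum.Base using (_⊎_; inj₁; inj₂; swap)
import Data.Sum.Base as Sum
open import Function.Base using (_∘_)
open import Level using (0ℓ)
open import Relation.Binary.Construct.Closure.ReflexiveTransitive using (Star)
open import Relation.Binary.Core using (Rel)
open import Relation.Binary.Definitions using (Decidable; Irreflexive; Symmetric)
open import Relation.Binary.PropositionalEquality
  using (_≡_; _≢_; _≗_; refl; sym; trans; cong)
open import Relation.Nullary using (¬_)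
open import Relation.Nullary.Decidable using (_×-dec_; _⊎-dec_; ¬?)

-- Simple graphs on the vertex type V.  Finite graphs are those with V = Fin N,
-- but V stays arbitrary so that induced subgraphs are again graphs.

record Graph (V : Set) : Set₁ where
  field
    Adj     : Rel V 0ℓ
    adj?    : Decidable Adj
    adj-sym : Symmetric Adj
    irrefl  : Irreflexive _≡_ Adj

open Graph public

Connected : ∀ {V} → Graph V → Set
Connected {V} G = (u v : V) → Star (Adj G) u v

Induced : ∀ {N} → Graph (Fin N) → (S : Subset N) → Graph (∃ λ v → v ∈ S)
Induced G S = record
  { Adj     = λ u v → Adj G (proj₁ u) (proj₁ v)
  ; adj?    = λ u v → adj? G (proj₁ u) (proj₁ v)
  ; adj-sym = adj-sym G
  ; irrefl  = irrefl G ∘ cong proj₁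
  }

-- The colours 1, …, k are the elements of Fin k; not all of them need be used.

IsProper : ∀ {V} → Graph V → (k : ℕ) → (V → Fin k) → Set
IsProper G k c = ∀ {u v} → Adj G u v → c u ≢ c v

IsLeast : (ℕ → Set) → ℕ → Set
IsLeast P n = P n × (∀ {t} → P t → n ≤ t)

IsChromaticNumber : ∀ {V} → Graph V → ℕ → Set
IsChromaticNumber {V} G = IsLeast λ k → Σ (V → Fin k) (IsProper G k)

PartialColoring : ∀ {N} → Graph (Fin N) → ℕ → Subset N → Set
PartialColoring G k S =
  Σ ((∃ λ v → v ∈ S) → Fin k) (IsProper (Induced G S) k)

IsSudoku : ∀ {N} (G : Graph (Fin N)) (k : ℕ) (S : Subset N) →
           PartialColoring G k S → Set
IsSudoku G k S (c₀ , _) =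
  ∃! _≗_ λ c → IsProper G k c × (c ∘ proj₁) ≗ c₀

-- The Sudoku number is only defined for connected graphs with χ(G) ≥ 2, so
-- being the Sudoku number of G includes these conditions on G.

record IsSudokuNumber {N : ℕ} (G : Graph (Fin N)) (s : ℕ) : Set where
  field
    connected : Connected G
    χ         : ℕ
    χ-number  : IsChromaticNumber G χ
    χ≥2       : 2 ≤ χ
    least     : IsLeast (λ t → ∃ λ S → ∣ S ∣ ≡ t × ∃ (IsSudoku G χ S)) s

-- C₂ₙ(Kₘ).  The vertex (i , p) is the p-th vertex of the i-th copy of Kₘ, with
-- i and p counted from 0.  The edge of a copy that is identified with a cycle
-- edge joins its vertices 0 and 1, so with 1-based cycle indices
-- x₂ᵢ₊₁ = (i , 0) and x₂ᵢ₊₂ = (i , 1).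

-- j is the successor of i in the cyclic order on Fin n.
CyclicSuc : ∀ {n} → Rel (Fin n) 0ℓ
CyclicSuc {n} i j =
  toℕ j ≡ suc (toℕ i) ⊎ (suc (toℕ i) ≡ n × toℕ j ≡ 0)

module _ {n m : ℕ} where

  SameCopy : Rel (Fin n × Fin m) 0ℓ
  SameCopy (i , p) (j , q) = i ≡ j × p ≢ q

  -- The cycle edge from x₂ᵢ₊₂ to x₂ᵢ₊₃, oriented along the cycle.
  Link : Rel (Fin n × Fin m) 0ℓ
  Link (i , p) (j , q) = toℕ p ≡ 1 × toℕ q ≡ 0 × CyclicSuc i j

  CKAdj : Rel (Fin n × Fin m) 0ℓ
  CKAdj u v = SameCopy u v ⊎ (Link u v ⊎ Link v u)

  ckAdj? : Decidable CKAdj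
  ckAdj? u v = sameCopy? u v ⊎-dec (link? u v ⊎-dec link? v u)
    where
    sameCopy? : Decidable SameCopy
    sameCopy? (i , p) (j , q) = (i Fin.≟ j) ×-dec ¬? (p Fin.≟ q)

    link? : Decidable Link
    link? (i , p) (j , q) =
      (toℕ p ℕ.≟ 1) ×-dec (toℕ q ℕ.≟ 0) ×-dec
      ((toℕ j ℕ.≟ suc (toℕ i)) ⊎-dec
       ((suc (toℕ i) ℕ.≟ n) ×-dec (toℕ j ℕ.≟ 0)))

  ckAdj-sym : Symmetric CKAdj
  ckAdj-sym = Sum.map (λ (i≡j , p≢q) → sym i≡j , p≢q ∘ sym) swap

  ckAdj-irrefl : Irreflexive _≡_ CKAdj
  ckAdj-irrefl refl (inj₁ (_ , p≢p))    = p≢p refl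
  ckAdj-irrefl refl (inj₂ (inj₁ link)) = noLoop link
    where
    noLoop : ∀ {u} → ¬ Link u u
    noLoop (p≡1 , p≡0 , _) with () ← trans (sym p≡1) p≡0
  ckAdj-irrefl refl (inj₂ (inj₂ link)) = ckAdj-irrefl refl (inj₂ (inj₁ link))

-- remQuot m : Fin (n * m) → Fin n × Fin m is the bijection inverse to combine.
C₂ₙ⟨K⟩ : (n m : ℕ) → Graph (Fin (n * m))
C₂ₙ⟨K⟩ n m = record
  { Adj     = λ u v → CKAdj (remQuot {n} m u) (remQuot {n} m v)
  ; adj?    = λ u v → ckAdj? (remQuot {n} m u) (remQuot {n} m v)
  ; adj-sym = ckAdj-sym
  ; irrefl  = ckAdj-irrefl ∘ cong (remQuot {n} m)
  }

{-# OPTIONS --safe #-}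
-- Lower bound: suppose three vertices of one copy are not prescribed.  Each has
-- at most one neighbour outside the copy, hence at most one colour that the
-- outside forbids, and one of the three, say w, has no neighbour outside.  If no
-- two of them could exchange their colours, then the colour of w would be
-- forbidden at both others u and v, so that u and v could exchange theirs.
-- Hence each copy contains at least m − 2 prescribed vertices.
--
-- Upper bound: prescribe all vertices but (i , 1) and (i , 2) in every copy i, so
-- that (i + 1 , 0) has one of the two colours missing in copy i.  Being adjacent
-- to (i + 1 , 0), the vertex (i , 1) must take the other one.
module Submission where

open import Defs
open import Data.Nat.Base using (ℕ; _≤_; _*_; _∸_)

open import Data.Empty using (⊥; ⊥-elim)
open import Data.Fin.Base
  using (Fin; zero; suc; toℕ; fromℕ<; inject₁; inject≤; lift; combine; remQuot)
open import Data.Fin.Patterns using (0F; 1F; 2F)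
open import Data.Fin.Permutation as Perm
  using (Permutation′; transpose; _⟨$⟩ʳ_; _⟨$⟩ˡ_)
import Data.Fin.Permutation.Components as PC
import Data.Fin.Properties as Fin
open import Data.Fin.Subset
  using (Subset; inside; outside; _∈_; _∉_; ∣_∣; ∁; ⊤)
open import Data.Fin.Subset.Properties
  using (∣∁p∣≡n∸∣p∣; ∣⊤∣≡n; ∈⊤; x∈∁p⇒x∉p)
open import Data.Nat.Base using (zero; suc; _+_; z≤n; s≤s)
import Data.Nat.Properties as ℕ
open import Data.Product.Base using (∃; _×_; _,_; proj₁; proj₂; uncurry)
open import Data.Sum.Base using (inj₁; inj₂)
open import Data.Vec.Base
  using (Vec; []; _∷_; _++_; concat; replicate; lookup; group; here; there)
open import Data.Vec.Properties
  using ([]=⇒lookup; lookup⇒[]=; lookup-concat; lookup-replicate)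
open import Function.Base using (_∘_)
open import Function.Bundles using (Injection)
open import Function.Definitions using (Injective)
open import Function.Properties.Inverse using (↔⇒↣)
open import Relation.Binary.Construct.Closure.ReflexiveTransitive
  using (Star; ε; _◅_; _◅◅_; gmap; reverse)
open import Relation.Binary.PropositionalEquality
  using (_≡_; _≢_; _≗_; refl; sym; trans; cong; cong₂; subst; subst₂;
         module ≡-Reasoning)
open import Relation.Nullary using (¬_; yes; no; contradiction)

private
  variable
    n m k : ℕ

-- Subsets of Fin

enumerate : (p : Subset n) →
            ∃ λ (f : Fin ∣ p ∣ → Fin n) → Injective _≡_ _≡_ f × (∀ j → f j ∈ p)
enumerate [] = (λ ()) , (λ { {()} }) , λ ()
enumerate (outside ∷ p) with enumerate p
... | f , f-inj , f∈p = suc ∘ f , f-inj ∘ Fin.suc-injective , there ∘ f∈p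
enumerate (inside ∷ p) with enumerate p
... | f , f-inj , f∈p = lift 1 f , Fin.lift-injective f f-inj 1 , λ
  { zero    → here
  ; (suc j) → there (f∈p j)
  }

¬3-missing⇒≤∣∣ : (p : Subset (2 + m)) →
  (∀ {x y z} → x ≢ y → x ≢ z → y ≢ z → x ∉ p → y ∉ p → z ∉ p → ⊥) →
  m ≤ ∣ p ∣
¬3-missing⇒≤∣∣ {m} p noTriple = ℕ.≮⇒≥ λ ∣p∣<m →
  -- The complement has `2 + (m ∸ ∣ p ∣)` elements, and the last summand is positive.
  let 3≤∣∁p∣ = subst (3 ≤_)
        (sym (trans (∣∁p∣≡n∸∣p∣ p) (ℕ.+-∸-assoc 2 (ℕ.<⇒≤ ∣p∣<m))))
        (s≤s (s≤s (ℕ.m<n⇒0<n∸m ∣p∣<m)))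
      f , f-inj , f∈∁p = enumerate (∁ p)
      g : Fin 3 → Fin (2 + m)
      g j = f (inject≤ j 3≤∣∁p∣)
      g≢ : ∀ {j l} → j ≢ l → g j ≢ g l
      g≢ j≢l = j≢l ∘ Fin.inject≤-injective _ _ _ _ ∘ f-inj
      g∉ : ∀ j → g j ∉ p
      g∉ j = x∈∁p⇒x∉p (f∈∁p _)
  in noTriple (g≢ {0F} {1F} λ ()) (g≢ {0F} {2F} λ ()) (g≢ {1F} {2F} λ ())
       (g∉ 0F) (g∉ 1F) (g∉ 2F)

∣++∣ : (p : Subset m) (q : Subset n) → ∣ p ++ q ∣ ≡ ∣ p ∣ + ∣ q ∣
∣++∣ []            q = refl
∣++∣ (outside ∷ p) q = ∣++∣ p q
∣++∣ (inside  ∷ p) q = cong suc (∣++∣ p q)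

∣concat-replicate∣ : ∀ n (p : Subset m) →
                     ∣ concat (replicate n p) ∣ ≡ n * ∣ p ∣
∣concat-replicate∣ zero    p = refl
∣concat-replicate∣ (suc n) p =
  trans (∣++∣ p _) (cong (∣ p ∣ +_) (∣concat-replicate∣ n p))

*≤∣concat∣ : (ps : Vec (Subset m) n) →
             (∀ i → k ≤ ∣ lookup ps i ∣) → n * k ≤ ∣ concat ps ∣
*≤∣concat∣ []       k≤ = z≤n
*≤∣concat∣ (p ∷ ps) k≤ rewrite ∣++∣ p (concat ps) =
  ℕ.+-mono-≤ (k≤ zero) (*≤∣concat∣ ps (k≤ ∘ suc))

∈-concat⁺ : (ps : Vec (Subset m) n) {i : Fin n} {x : Fin m} →
            x ∈ lookup ps i → combine i x ∈ concat ps
∈-concat⁺ ps x∈ =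
  lookup⇒[]= _ _ (trans (lookup-concat ps _ _) ([]=⇒lookup x∈))

∈-concat⁻ : (ps : Vec (Subset m) n) {i : Fin n} {x : Fin m} →
            combine i x ∈ concat ps → x ∈ lookup ps i
∈-concat⁻ ps x∈ =
  lookup⇒[]= _ _ (trans (sym (lookup-concat ps _ _)) ([]=⇒lookup x∈))

-- Permutations of Fin

⟨$⟩ʳ-injective : (π : Permutation′ n) → Injective _≡_ _≡_ (π ⟨$⟩ʳ_)
⟨$⟩ʳ-injective π = Injection.injective (↔⇒↣ π)

-- The value of the transposition is an index, so that matching on the view replaces it in the goal
-- without repeating the two equality tests.
data TransposeView (a b : Fin n) (x : Fin n) : Fin n → Set where
  at-first  : x ≡ a → TransposeView a b x b
  at-second : x ≡ b → TransposeView a b x a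
  elsewhere : x ≢ a → x ≢ b → TransposeView a b x x

transposeView : (a b x : Fin n) → TransposeView a b x (PC.transpose a b x)
transposeView a b x with x Fin.≟ a
... | yes x≡a = at-first x≡a
... | no  x≢a with x Fin.≟ b
...   | yes x≡b = at-second x≡b
...   | no  x≢b = elsewhere x≢a x≢b

transpose-first : (a b : Fin n) → PC.transpose a b a ≡ b
transpose-first a b with PC.transpose a b a | transposeView a b a
... | _ | at-first  _     = refl
... | _ | at-second a≡b   = a≡b
... | _ | elsewhere a≢a _ = contradiction refl a≢a

transpose-elsewhere : {a b x : Fin n} → x ≢ a → x ≢ b → PC.transpose a b x ≡ x
transpose-elsewhere {a = a} {b} {x} x≢a x≢b
  with PC.transpose a b x | transposeView a b x
... | _ | at-first  x≡a = contradiction x≡a x≢a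
... | _ | at-second x≡b = contradiction x≡b x≢b
... | _ | elsewhere _ _ = refl

-- For `x ≢ y` and `a ≢ b`, this takes `x` to `a` and `y` to `b`: the second transposition starts
-- where the first has left `y`, and does not move `a`.
transpose² : (x y a b : Fin n) → Permutation′ n
transpose² x y a b =
  transpose x a Perm.∘ₚ transpose (transpose x a ⟨$⟩ʳ y) b

module _ {x y a b : Fin n} where

  transpose²-first : x ≢ y → a ≢ b → transpose² x y a b ⟨$⟩ʳ x ≡ a
  transpose²-first x≢y a≢b = begin
    PC.transpose y′ b (PC.transpose x a x)
      ≡⟨ cong (PC.transpose y′ b) (transpose-first x a) ⟩
    PC.transpose y′ b a
      ≡⟨ transpose-elsewhere a≢y′ a≢b ⟩
    a
      ∎
    where
    open ≡-Reasoning
    y′ = PC.transpose x a y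
    a≢y′ : a ≢ y′
    a≢y′ a≡y′ = x≢y (⟨$⟩ʳ-injective (transpose x a)
                       (trans (transpose-first x a) a≡y′))

  transpose²-second : transpose² x y a b ⟨$⟩ʳ y ≡ b
  transpose²-second = transpose-first (PC.transpose x a y) b

-- The cyclic order

cyclicSuc-functional : {i j l : Fin n} → CyclicSuc i j → CyclicSuc i l → j ≡ l
cyclicSuc-functional (inj₁ p) (inj₁ q) = Fin.toℕ-injective (trans p (sym q))
cyclicSuc-functional {j = j} (inj₁ p) (inj₂ (e , _)) =
  contradiction (trans p e) (ℕ.<⇒≢ (Fin.toℕ<n j))
cyclicSuc-functional {l = l} (inj₂ (e , _)) (inj₁ q) =
  contradiction (trans q e) (ℕ.<⇒≢ (Fin.toℕ<n l))
cyclicSuc-functional (inj₂ (_ , p)) (inj₂ (_ , q)) =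
  Fin.toℕ-injective (trans p (sym q))

cyclicSuc-injective : {i j l : Fin n} → CyclicSuc i l → CyclicSuc j l → i ≡ j
cyclicSuc-injective (inj₁ p) (inj₁ q) =
  Fin.toℕ-injective (ℕ.suc-injective (trans (sym p) q))
cyclicSuc-injective (inj₁ p) (inj₂ (_ , q)) with () ← trans (sym p) q
cyclicSuc-injective (inj₂ (_ , p)) (inj₁ q) with () ← trans (sym p) q
cyclicSuc-injective (inj₂ (p , _)) (inj₂ (q , _)) =
  Fin.toℕ-injective (ℕ.suc-injective (trans p (sym q)))

cyclicSuc-total : (i : Fin n) → ∃ (CyclicSuc i)
cyclicSuc-total {suc n} i with suc (toℕ i) ℕ.<? suc n
... | yes i<n = fromℕ< i<n , inj₁ (Fin.toℕ-fromℕ< i<n)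
... | no  i≮n = zero , inj₂ (ℕ.≤-antisym (Fin.toℕ<n i) (ℕ.≮⇒≥ i≮n) , refl)

next : Fin n → Fin n
next = proj₁ ∘ cyclicSuc-total

-- C₂ₙ(Kₘ) on pairs

-- Properness passes from `CK` to `C₂ₙ⟨K⟩` by definition, since adjacency in the latter is `CKAdj`
-- after `remQuot`. The way back is `∘combine-proper`.
CK : (n m : ℕ) → Graph (Fin n × Fin m)
CK n m = record
  { Adj     = CKAdj
  ; adj?    = ckAdj?
  ; adj-sym = ckAdj-sym
  ; irrefl  = ckAdj-irrefl
  }

combine-adj : {u v : Fin n × Fin m} → CKAdj u v →
              Adj (C₂ₙ⟨K⟩ n m) (uncurry combine u) (uncurry combine v)
combine-adj {u = i , p} {j , q} =
  subst₂ CKAdj (sym (Fin.remQuot-combine i p)) (sym (Fin.remQuot-combine j q))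

∘combine-proper : {c : Fin (n * m) → Fin k} →
  IsProper (C₂ₙ⟨K⟩ n m) k c → IsProper (CK n m) k (c ∘ uncurry combine)
∘combine-proper proper = proper ∘ combine-adj

copy-injective : {c : Fin n × Fin m → Fin k} → IsProper (CK n m) k c →
                 ∀ i → Injective _≡_ _≡_ (λ p → c (i , p))
copy-injective proper i {p} {q} cp≡cq with p Fin.≟ q
... | yes p≡q = p≡q
... | no  p≢q = contradiction cp≡cq (proper (inj₁ (refl , p≢q)))

within-copy : (i : Fin n) (p q : Fin m) → Star CKAdj (i , p) (i , q)
within-copy i p q with p Fin.≟ q
... | yes refl = ε
... | no  p≢q  = inj₁ (refl , p≢q) ◅ ε

CK-connected : Connected (CK n (2 + m))
CK-connected {zero} (() , _)
CK-connected {suc n} {m} u v = reverse ckAdj-sym (fromRoot u) ◅◅ fromRoot v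
  where
  -- The induction is on `t` because `inject₁ i`, the preceding copy, is not structurally smaller
  -- than `suc i`.
  toCopy : ∀ t (i : Fin (suc n)) → toℕ i ≡ t →
           Star (CKAdj {m = 2 + m}) (zero , zero) (i , zero)
  toCopy zero    zero    _  = ε
  toCopy (suc t) (suc i) eq =
    toCopy t (inject₁ i) (trans (Fin.toℕ-inject₁ i) (ℕ.suc-injective eq))
    ◅◅ within-copy _ 0F 1F
    ◅◅ (inj₂ (inj₁ (refl , refl , inj₁ (cong suc (sym (Fin.toℕ-inject₁ i)))))
        ◅ ε)

  fromRoot : ∀ w → Star (CKAdj {suc n} {2 + m}) (zero , zero) w
  fromRoot (i , p) = toCopy (toℕ i) i refl ◅◅ within-copy i 0F p

C₂ₙ⟨K⟩-connected : Connected (C₂ₙ⟨K⟩ n (2 + m))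
C₂ₙ⟨K⟩-connected {n} {m} u v =
  subst₂ (Star _)
    (Fin.combine-remQuot {n} (2 + m) u) (Fin.combine-remQuot {n} (2 + m) v)
    (gmap (uncurry combine) combine-adj
      (CK-connected (remQuot {n} (2 + m) u) (remQuot {n} (2 + m) v)))

-- The lower bound

Outer : Fin n → Fin m → Fin n × Fin m → Set
Outer i p v = proj₁ v ≢ i × CKAdj (i , p) v

-- An edge leaving a copy is a link, forwards from position 1 or backwards from position 0. The
-- position thus fixes the direction, and the cyclic order fixes the other end.
outer-unique : {i : Fin n} {p : Fin m} {u v : Fin n × Fin m} →
               Outer i p u → Outer i p v → u ≡ v
outer-unique (i≢ , inj₁ (i≡ , _)) _ = contradiction (sym i≡) i≢
outer-unique _ (i≢ , inj₁ (i≡ , _)) = contradiction (sym i≡) i≢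
outer-unique (_ , inj₂ (inj₁ (_ , q≡ , s))) (_ , inj₂ (inj₁ (_ , q′≡ , s′))) =
  cong₂ _,_ (cyclicSuc-functional s s′) (Fin.toℕ-injective (trans q≡ (sym q′≡)))
outer-unique (_ , inj₂ (inj₂ (q≡ , _ , s))) (_ , inj₂ (inj₂ (q′≡ , _ , s′))) =
  cong₂ _,_ (cyclicSuc-injective s s′) (Fin.toℕ-injective (trans q≡ (sym q′≡)))
outer-unique (_ , inj₂ (inj₁ (p≡1 , _))) (_ , inj₂ (inj₂ (_ , p≡0 , _)))
  with () ← trans (sym p≡1) p≡0
outer-unique (_ , inj₂ (inj₂ (_ , p≡0 , _))) (_ , inj₂ (inj₁ (p≡1 , _)))
  with () ← trans (sym p≡1) p≡0

¬outer-suc² : {i : Fin n} {p : Fin m} {v : Fin n × Fin (2 + m)} →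
              ¬ Outer i (suc (suc p)) v
¬outer-suc² (i≢ , inj₁ (i≡ , _))             = i≢ (sym i≡)
¬outer-suc² (_ , inj₂ (inj₁ (() , _)))
¬outer-suc² (_ , inj₂ (inj₂ (_ , () , _)))

module _ {c : Fin n × Fin m → Fin k} (proper : IsProper (CK n m) k c)
         (i : Fin n) where

  Blocked : Fin m → Fin k → Set
  Blocked p κ = ∃ λ v → Outer i p v × c v ≡ κ

  blocked-unique : ∀ {p κ κ′} → Blocked p κ → Blocked p κ′ → κ ≡ κ′
  blocked-unique (u , pu , refl) (v , pv , refl) = cong c (outer-unique pu pv)

  swapped : Fin m → Fin m → Fin n × Fin m → Fin k
  swapped a b (j , x) with j Fin.≟ i
  ... | yes _ = c (j , PC.transpose a b x)
  ... | no  _ = c (j , x)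

  Exchangeable : Fin m → Fin m → Set
  Exchangeable a b = ¬ Blocked a (c (i , b)) × ¬ Blocked b (c (i , a))

  -- Inside copy `i` the exchange permutes distinct colours, and away from it nothing changes. On an
  -- edge leaving the copy, a new conflict would make a colour blocked at `a` or `b`, against
  -- `Exchangeable`.
  swapped-proper : ∀ {a b} → Exchangeable a b →
                   IsProper (CK n m) k (swapped a b)
  swapped-proper {a} {b} (¬a , ¬b) {j , x} {l , y} adj
    with j Fin.≟ i | l Fin.≟ i
  ... | no  _    | no  _    = proper adj
  ... | yes refl | yes refl = λ eq →
    irrefl (CK n m)
      (cong (i ,_) (⟨$⟩ʳ-injective (transpose a b) (copy-injective proper i eq)))
      adj
  ... | yes refl | no  l≢i with PC.transpose a b x | transposeView a b x
  ...   | _ | at-first  refl = λ eq → ¬a ((l , y) , (l≢i , adj) , sym eq)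
  ...   | _ | at-second refl = λ eq → ¬b ((l , y) , (l≢i , adj) , sym eq)
  ...   | _ | elsewhere _ _  = proper adj
  swapped-proper {a} {b} (¬a , ¬b) {j , x} {l , y} adj
      | no  j≢i  | yes refl with PC.transpose a b y | transposeView a b y
  ...   | _ | at-first  refl = λ eq → ¬a ((j , x) , (j≢i , ckAdj-sym adj) , eq)
  ...   | _ | at-second refl = λ eq → ¬b ((j , x) , (j≢i , ckAdj-sym adj) , eq)
  ...   | _ | elsewhere _ _  = proper adj

  swapped-first : ∀ a b → swapped a b (i , a) ≡ c (i , b)
  swapped-first a b with i Fin.≟ i
  ... | yes _   = cong (λ x → c (i , x)) (transpose-first a b)
  ... | no  i≢i = contradiction refl i≢i

  swapped-agrees : ∀ {a b j x} → (j ≡ i → x ≢ a × x ≢ b) →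
                   swapped a b (j , x) ≡ c (j , x)
  swapped-agrees {j = j} x≢ with j Fin.≟ i
  ... | yes j≡i = cong (λ y → c (j , y)) (uncurry transpose-elsewhere (x≢ j≡i))
  ... | no  _   = refl

  ¬unexchangeable-with-unblocked : ∀ {u v w} → u ≢ w → v ≢ w →
    (∀ {κ} → ¬ Blocked w κ) →
    ¬ Exchangeable u w → ¬ Exchangeable v w → ¬ Exchangeable u v → ⊥
  ¬unexchangeable-with-unblocked u≢w v≢w w-free ¬uw ¬vw ¬uv =
    -- `Blocked` is never decided: the conflicts of `u` and of `v` with the colour of `w` are
    -- assumed in turn under nested negations. Any further colour blocked at `u` or `v` would then
    -- equal that of `w`.
    ¬uw ((λ u-blocks-w → ¬vw ((λ v-blocks-w →
      ¬uv ( (λ u-blocks-v → v≢w (sym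
              (copy-injective proper i (blocked-unique u-blocks-w u-blocks-v))))
          , (λ v-blocks-u → u≢w (sym
              (copy-injective proper i (blocked-unique v-blocks-w v-blocks-u))))))
      , w-free)) , w-free)

-- Positions 0 and 1 hold at most two of three distinct vertices, so one of `p`, `q`, `r` is at
-- least 2 and has no outer neighbour. `A` will stand for not being prescribed.
¬unexchangeable-triple : {c : Fin n × Fin (2 + m) → Fin k}
  (proper : IsProper (CK n (2 + m)) k c) (i : Fin n) (A : Fin (2 + m) → Set) →
  (∀ {a b} → A a → A b → a ≢ b → ¬ Exchangeable proper i a b) →
  ∀ {p q r} → p ≢ q → p ≢ r → q ≢ r → A p → A q → A r → ⊥
¬unexchangeable-triple proper i A ¬ex {p} {q} {r} = go p q r
  where
  via : ∀ u v w → (∀ {κ} → ¬ Blocked proper i w κ) →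
        u ≢ w → v ≢ w → u ≢ v → A u → A v → A w → ⊥
  via u v w w-free u≢w v≢w u≢v Au Av Aw =
    ¬unexchangeable-with-unblocked proper i u≢w v≢w w-free
      (¬ex Au Aw u≢w) (¬ex Av Aw v≢w) (¬ex Au Av u≢v)

  suc²-free : ∀ {x κ} → ¬ Blocked proper i (suc (suc x)) κ
  suc²-free (_ , outer , _) = ¬outer-suc² outer

  go : ∀ p q r → p ≢ q → p ≢ r → q ≢ r → A p → A q → A r → ⊥
  go p q (suc (suc r)) p≢q p≢r q≢r Ap Aq Ar =
    via p q _ suc²-free p≢r q≢r p≢q Ap Aq Ar
  go p (suc (suc q)) r p≢q p≢r q≢r Ap Aq Ar =
    via p r _ suc²-free p≢q (q≢r ∘ sym) p≢r Ap Ar Aq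
  go (suc (suc p)) q r p≢q p≢r q≢r Ap Aq Ar =
    via q r _ suc²-free (p≢q ∘ sym) (p≢r ∘ sym) q≢r Aq Ar Ap
  go 0F 0F _  p≢q _ _ _ _ _ = p≢q refl
  go 1F 1F _  p≢q _ _ _ _ _ = p≢q refl
  go 0F 1F 0F _ p≢r _ _ _ _ = p≢r refl
  go 1F 0F 1F _ p≢r _ _ _ _ = p≢r refl
  go 0F 1F 1F _ _ q≢r _ _ _ = q≢r refl
  go 1F 0F 0F _ _ q≢r _ _ _ = q≢r refl

-- Exchanging the colours of two exchangeable vertices of one copy, both outside `S`, respects the
-- clues. Uniqueness then gives back `c`, so that two distinct vertices of a complete graph share a
-- colour.
sudoku-≤ : ∀ {t} {S : Subset (n * (2 + m))} → ∣ S ∣ ≡ t →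
           ∃ (IsSudoku (C₂ₙ⟨K⟩ n (2 + m)) k S) → n * m ≤ t
sudoku-≤ {n} {m} {k} {S = S} refl ((c₀ , _) , c , (proper , extends) , unique)
  -- `group` cuts `S` into one subset per copy, so that the bound `m` can be proved copy by copy and
  -- summed.
  with group n (2 + m) S
... | rows , refl = *≤∣concat∣ rows λ i →
  ¬3-missing⇒≤∣∣ (lookup rows i)
    (¬unexchangeable-triple proper′ i (_∉ lookup rows i) (¬exchangeable i))
  where
  proper′ : IsProper (CK n (2 + m)) k (c ∘ uncurry combine)
  proper′ = ∘combine-proper proper

  ¬exchangeable : ∀ i {a b} → a ∉ lookup rows i → b ∉ lookup rows i → a ≢ b →
                  ¬ Exchangeable proper′ i a b
  ¬exchangeable i {a} {b} a∉ b∉ a≢b ex =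
    a≢b (copy-injective proper′ i same)
    where
    c′ : Fin n × Fin (2 + m) → Fin k
    c′ = swapped proper′ i a b

    agrees : ∀ j x → x ∈ lookup rows j → c′ (j , x) ≡ c (combine j x)
    agrees j x x∈ = swapped-agrees proper′ i λ { refl →
      (λ { refl → a∉ x∈ }) , (λ { refl → b∉ x∈ }) }

    c′-extends : ∀ v → c′ (remQuot {n} (2 + m) (proj₁ v)) ≡ c₀ v
    c′-extends (v , v∈S) = begin
      c′ (remQuot {n} (2 + m) v)
        ≡⟨ agrees _ _ (∈-concat⁻ rows v∈S′) ⟩
      c (uncurry combine (remQuot {n} (2 + m) v))
        ≡⟨ cong c v≡ ⟩
      c v
        ≡⟨ extends (v , v∈S) ⟩
      c₀ (v , v∈S)
        ∎
      where
      open ≡-Reasoning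
      v≡ = Fin.combine-remQuot {n} (2 + m) v
      v∈S′ = subst (_∈ concat rows) (sym v≡) v∈S

    same : c (combine i a) ≡ c (combine i b)
    same = begin
      c (combine i a)
        ≡⟨ unique ((λ {u} {v} → swapped-proper proper′ i ex) , c′-extends) _ ⟩
      c′ (remQuot {n} (2 + m) (combine i a))
        ≡⟨ cong c′ (Fin.remQuot-combine i a) ⟩
      c′ (i , a)
        ≡⟨ swapped-first proper′ i a b ⟩
      c (combine i b)
        ∎
      where open ≡-Reasoning

-- The upper bound

-- 2 0 1 0 1 0 1 …: the leading 2 keeps cyclic neighbours distinct when the
-- number of copies is odd.
firstColour : ℕ → Fin (3 + m)
firstColour 0                   = 2F
firstColour 1                   = 0F
firstColour 2                   = 1F
firstColour (suc (suc (suc t))) = firstColour (suc t)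

firstColour-suc : ∀ t → firstColour {m} t ≢ firstColour (suc t)
firstColour-suc 0                   ()
firstColour-suc 1                   ()
firstColour-suc 2                   ()
firstColour-suc (suc (suc (suc t))) = firstColour-suc (suc t)

-- This serves the link that closes the cycle: the colour `2F` occurs at index 0 only.
firstColour-0 : ∀ t → firstColour {m} (suc t) ≢ firstColour 0
firstColour-0 0             ()
firstColour-0 1             ()
firstColour-0 (suc (suc t)) = firstColour-0 t

hints : Subset (3 + m)
hints = inside ∷ outside ∷ outside ∷ ⊤

suc³∈hints : {p : Fin m} → suc (suc (suc p)) ∈ hints
suc³∈hints = there (there (there ∈⊤))

allHints : (n m : ℕ) → Subset (n * (3 + m))
allHints n m = concat (replicate n hints)

∣allHints∣ : ∀ n m → ∣ allHints n m ∣ ≡ n * suc m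
∣allHints∣ n m = trans (∣concat-replicate∣ n (hints {m}))
                       (cong (λ t → n * suc t) (∣⊤∣≡n m))

∈allHints : (i : Fin n) {p : Fin (3 + m)} → p ∈ hints → combine i p ∈ allHints n m
∈allHints {n} i {p} p∈ = ∈-concat⁺ (replicate n hints)
  (subst (p ∈_) (sym (lookup-replicate i hints)) p∈)

module _ {n m : ℕ} (2≤n : 2 ≤ n) where

  first : Fin n → Fin (3 + m)
  first i = firstColour (toℕ i)

  first-cyclicSuc : ∀ {i j} → CyclicSuc i j → first i ≢ first j
  first-cyclicSuc {i} {j} (inj₁ j≡) rewrite j≡ = firstColour-suc (toℕ i)
  first-cyclicSuc {i} {j} (inj₂ (i≡ , j≡)) with toℕ i | toℕ j
  -- A single copy would be its own cyclic successor; `2 ≤ n` excludes this.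
  first-cyclicSuc (inj₂ (refl , refl)) | zero  | _ = contradiction 2≤n λ { (s≤s ()) }
  first-cyclicSuc (inj₂ (refl , refl)) | suc t | _ = firstColour-0 t

  -- Position 2 gets the colour of position 0 in the next copy. That colour is therefore among the
  -- two left open by the hints, and the link forbids it at position 1.
  copyColouring : Fin n → Permutation′ (3 + m)
  copyColouring i = transpose² 0F 2F (first i) (first (next i))

  solution : Fin n × Fin (3 + m) → Fin (3 + m)
  solution (i , p) = copyColouring i ⟨$⟩ʳ p

  solution-0 : ∀ i → solution (i , 0F) ≡ first i
  solution-0 i =
    transpose²-first {x = 0F} {2F} (λ ()) (first-cyclicSuc (proj₂ (cyclicSuc-total i)))

  solution-2 : ∀ {i j} → CyclicSuc i j → solution (i , 2F) ≡ solution (j , 0F)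
  solution-2 {i} {j} s = begin
    solution (i , 2F)
      ≡⟨ transpose²-second {x = 0F} {2F} {first i} {first (next i)} ⟩
    first (next i)
      ≡⟨ cong first (cyclicSuc-functional (proj₂ (cyclicSuc-total i)) s) ⟩
    first j
      ≡⟨ solution-0 j ⟨
    solution (j , 0F)
      ∎
    where open ≡-Reasoning

  -- The far end of the link has the colour of `(i , 2F)`, and `copyColouring i` is injective.
  solution-link : ∀ {u v} → Link u v → solution u ≢ solution v
  solution-link {i , 1F} {j , 0F} (_ , _ , s) eq
    with () ← ⟨$⟩ʳ-injective (copyColouring i) {1F} {2F} (trans eq (sym (solution-2 s)))
  solution-link {_ , 0F}            (() , _)
  solution-link {_ , suc (suc _)}   (() , _)
  solution-link {_ , 1F} {_ , suc _} (_ , () , _)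

  solution-proper : IsProper (CK n (3 + m)) (3 + m) solution
  solution-proper {i , p} (inj₁ (refl , p≢q)) =
    p≢q ∘ ⟨$⟩ʳ-injective (copyColouring i)
  solution-proper (inj₂ (inj₁ link)) = solution-link link
  solution-proper (inj₂ (inj₂ link)) = solution-link link ∘ sym

  module _ {c : Fin n × Fin (3 + m) → Fin (3 + m)}
           (proper : IsProper (CK n (3 + m)) (3 + m) c)
           (agrees : ∀ i p → p ∈ hints → c (i , p) ≡ solution (i , p)) where

    -- Each copy of the solution uses every colour exactly once. A colour of `c` can thus be named
    -- by the position `q` where the solution uses it, which turns uniqueness into a case analysis
    -- on `q`.
    preimage : ∀ v → ∃ λ q → solution (proj₁ v , q) ≡ c v
    preimage (i , p) = copyColouring i ⟨$⟩ˡ c (i , p) , Perm.inverseʳ (copyColouring i)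

    hinted-taken : ∀ {i p q} → q ∈ hints → p ≢ q → solution (i , q) ≢ c (i , p)
    hinted-taken {i} {p} {q} q∈ p≢q eq =
      proper (inj₁ (refl , p≢q)) (sym (trans (agrees i q q∈) eq))

    determined-1 : ∀ i → solution (i , 1F) ≡ c (i , 1F)
    determined-1 i with preimage (i , 1F)
    ... | 0F , eq = contradiction eq (hinted-taken here λ ())
    ... | 1F , eq = eq
    -- This is the colour of the prescribed vertex at position 0 of the next copy, to which
    -- `(i , 1F)` is linked.
    ... | 2F , eq = ⊥-elim (proper (inj₂ (inj₁ (refl , refl , s)))
            (sym (trans (agrees _ 0F here) (trans (sym (solution-2 s)) eq))))
      where s = proj₂ (cyclicSuc-total i)
    ... | suc (suc (suc q)) , eq = contradiction eq (hinted-taken suc³∈hints λ ())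

    determined-2 : ∀ i → solution (i , 2F) ≡ c (i , 2F)
    determined-2 i with preimage (i , 2F)
    ... | 0F , eq = contradiction eq (hinted-taken here λ ())
    -- This colour is already taken by `(i , 1F)`.
    ... | 1F , eq = ⊥-elim (proper (inj₁ (refl , λ ()))
            (trans (sym (determined-1 i)) eq))
    ... | 2F , eq = eq
    ... | suc (suc (suc q)) , eq = contradiction eq (hinted-taken suc³∈hints λ ())

    determined : ∀ v → solution v ≡ c v
    determined (i , 0F)                  = sym (agrees i 0F here)
    determined (i , 1F)                  = determined-1 i
    determined (i , 2F)                  = determined-2 i
    determined (i , p@(suc (suc (suc _)))) = sym (agrees i p suc³∈hints)

  allHints-sudoku : ∃ (IsSudoku (C₂ₙ⟨K⟩ n (3 + m)) (3 + m) (allHints n m))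
  allHints-sudoku =
    (sol ∘ proj₁ , solution-proper) , sol , (solution-proper , λ _ → refl) , unique
    where
    sol : Fin (n * (3 + m)) → Fin (3 + m)
    sol = solution ∘ remQuot {n} (3 + m)

    unique : {c : Fin (n * (3 + m)) → Fin (3 + m)} →
             IsProper (C₂ₙ⟨K⟩ n (3 + m)) (3 + m) c ×
             (∀ v → c (proj₁ {B = _∈ allHints n m} v) ≡ sol (proj₁ v)) →
             sol ≗ c
    unique {c} (proper , extends) v =
      trans (determined (∘combine-proper proper) agrees (remQuot {n} (3 + m) v))
            (cong c (Fin.combine-remQuot {n} (3 + m) v))
      where
      agrees : ∀ i p → p ∈ hints → c (combine i p) ≡ solution (i , p)
      agrees i p p∈ = trans (extends (combine i p , ∈allHints i p∈))
                            (cong solution (Fin.remQuot-combine i p))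

  chromaticNumber : IsChromaticNumber (C₂ₙ⟨K⟩ n (3 + m)) (3 + m)
  chromaticNumber =
    (solution ∘ remQuot {n} (3 + m) , solution-proper) , λ (c , proper) →
    Fin.injective⇒≤ (copy-injective (∘combine-proper {n = n} proper)
                       -- Any copy forces `3 + m` distinct colours. Here `2 ≤ n` is weakened to
                       -- `0 < n`, which yields copy 0.
                       (fromℕ< (ℕ.<⇒≤ 2≤n)))

theorem3p10 : (n m : ℕ) → 2 ≤ n → 3 ≤ m → IsSudokuNumber (C₂ₙ⟨K⟩ n m) (n * (m ∸ 2))
theorem3p10 n (suc (suc (suc m))) 2≤n (s≤s (s≤s (s≤s z≤n))) = record
  { connected = C₂ₙ⟨K⟩-connected
  ; χ         = 3 + m
  ; χ-number  = chromaticNumber 2≤n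
  ; χ≥2       = s≤s (s≤s z≤n)
  ; least     = (allHints n m , ∣allHints∣ n m , allHints-sudoku 2≤n)
              -- With `3 + m` vertices per copy, `sudoku-≤` is applied at `suc m`, to which
              -- `(3 + m) ∸ 2` computes.
              , λ (_ , ∣S∣≡t , sudoku) → sudoku-≤ ∣S∣≡t sudoku
  }
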